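{- Let $m,N,p$ be natural numbers with $m\geq 3$, $m\mid N$, $m<N$, and let $p$ be prime with $p\equiv -1\pmod m$. Write $N=\sum_i d_i p^i$ in base $p$ (so $0\le d_i<p$), and set $$A=\sum_{i\text{ even}}d_i,\qquad B=\sum_{i\text{ odd}}d_i.$$ Then $$v_p(G(N;m))=\begin{cases}2,& (A,B)=(1,1)\text{ and }p=m-1,\\ 1,& (A,B)=(1,1)\text{ and }m<p,\\ 1,& (A,B)=(m,0)\text{ or }(A,B)=(0,m),\\ 0,&\text{otherwise.}\end{cases}$$
   Context: For integers $m\ge 2$ and $N$ with $m\mid N$, define $G(N;m)=\gcd\left\{\binom Nk:0<k<N,\ m\mid k\right\}$, where $k$ ranges over integers. For a prime $p$ and a positive integer $x$, $v_p(x)$ denotes the exponent of $p$ in $x$. Digit positions are indexed from $i=0$ (the units digit). -}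

module Defs where

open import Data.Bool.Base using (if_then_else_)
open import Data.Digit using (Expansion)
open import Data.Fin.Base using (toℕ)
open import Data.Integer.Base as ℤ using (ℤ; +_)
import Data.Integer.Divisibility as ℤ
open import Data.List.Base using (List; []; _∷_; filter; foldr; map; upTo)
open import Data.Nat.Base using (ℕ; zero; suc; _+_; _^_)
open import Data.Nat.Combinatorics using (_C_)
open import Data.Nat.Divisibility using (_∣?_)
open import Data.Nat.GCD using (gcd)
open import Data.Nat.Properties using (_<?_)
open import Relation.Nullary.Decidable using (does; _×-dec_)

infix 4 _≡_[mod_]

_≡_[mod_] : ℤ → ℤ → ℕ → Set
a ≡ b [mod m ] = (+ m) ℤ.∣ (a ℤ.- b)

-- The list of all k with 0 < k < N and m ∣ k; the upper bound comes from
-- upTo N = 0 ∷ … ∷ N - 1.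

indices : ℕ → ℕ → List ℕ
indices N m = filter (λ k → (0 <? k) ×-dec (m ∣? k)) (upTo N)

-- The gcd of the empty family is 0; it is empty only when there is no
-- multiple of m strictly between 0 and N.

G : ℕ → ℕ → ℕ
G N m = foldr gcd 0 (map (N C_) (indices N m))

-- greatestExponent p x b is the greatest e ≤ b with p ^ e ∣ x.

greatestExponent : ℕ → ℕ → ℕ → ℕ
greatestExponent p x zero    = 0
greatestExponent p x (suc b) =
  if does (p ^ suc b ∣? x) then suc b else greatestExponent p x b

-- For p ≥ 2 and x > 0, p ^ e ∣ x forces e < p ^ e ≤ x, so searching up to x
-- loses nothing.  Outside that range the value is junk (e.g. v p 0 = 0).

v : ℕ → ℕ → ℕ
v p x = greatestExponent p x x

-- Expansions list the units digit first, so removing the head shifts every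
-- position by one and exchanges even and odd positions.

mutual
  evenDigitSum : ∀ {p} → Expansion p → ℕ
  evenDigitSum []       = 0
  evenDigitSum (d ∷ ds) = toℕ d + oddDigitSum ds

  oddDigitSum : ∀ {p} → Expansion p → ℕ
  oddDigitSum []       = 0
  oddDigitSum (d ∷ ds) = evenDigitSum ds

{-# OPTIONS --safe #-}
module Submission where

open import Defs
open import Data.Digit using (Expansion; fromDigits)
open import Data.Fin.Base using (Fin; zero; suc; toℕ; fromℕ; fromℕ<; inject₁)
open import Data.Fin.Properties using (toℕ<n; toℕ-fromℕ; toℕ-fromℕ<; toℕ-inject₁)
open import Data.List.Base using ([]; _∷_; map; foldr)
open import Data.List.Membership.Propositional using (_∈_)
open import Data.List.Membership.Propositional.Properties
  using (∈-filter⁺; ∈-filter⁻; ∈-upTo⁺; ∈-upTo⁻)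
open import Data.List.Relation.Unary.Any using (here; there)
open import Data.Nat.Base
open import Data.Nat.Combinatorics using (_C_; nCk≡n!/k![n-k]!; [n∸k]!k!∣n!)
open import Data.Nat.Divisibility
open import Data.Nat.DivMod using (_%_; _divMod_; result; m/n*n≡m; m<n⇒m%n≡m; [m+kn]%n≡m%n)
open import Data.Nat.GCD using (gcd; gcd-greatest; gcd[m,n]∣m; gcd[m,n]∣n)
open import Data.Nat.Primality
  using (Prime; euclidsLemma; prime⇒nonZero; prime⇒nonTrivial; ¬prime[0]; ¬prime[1])
open import Data.Nat.Properties
open import Data.Nat.Tactic.RingSolver using (solve-∀)
open import Data.Product.Base using (∃; ∃₂; _×_; _,_; proj₁; proj₂)
open import Data.Sum.Base using (_⊎_; inj₁; inj₂; [_,_]′)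
open import Function.Base using (_∘_)
open import Relation.Binary.PropositionalEquality
open import Relation.Nullary.Decidable using (dec-true; dec-false; yes; no; _×-dec_)
open import Relation.Nullary.Negation using (¬_; contradiction)

-- By Kummer's theorem the exponent of p in N C k is the number of carries in
-- the base p addition of k and N - k, so v p (G N m) is the least number of
-- carries over the admissible k.  As p ≡ -1 modulo m, a number is congruent to
-- its even digit sum minus its odd digit sum.  Without carries the digit sums
-- of k and N - k add up to (A , B), while each carry removes 1 from one of the
-- two sums and adds p to the other.  Hence an admissible k without carries
-- amounts to splitting off a proper part (a , b) of (A , B) with m ∣ a - b, and
-- this fails only for (1 , 1), (m , 0) and (0 , m).  For these a borrow from a
-- suitable digit gives an admissible k with one carry, except when (A , B) is
-- (1 , 1) and m = p + 1: one carry then turns it into (m , 0) or (0 , m), which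
-- are still unsplittable, but two consecutive carries suffice.

-- Divisibility by the gcd of a family, and exact prime exponents.

foldr-gcd∣ : ∀ {A : Set} (f : A → ℕ) {xs x} → x ∈ xs → foldr gcd 0 (map f xs) ∣ f x
foldr-gcd∣ f {y ∷ ys} (here refl)  = gcd[m,n]∣m (f y) _
foldr-gcd∣ f {y ∷ ys} (there x∈ys) = ∣-trans (gcd[m,n]∣n (f y) _) (foldr-gcd∣ f x∈ys)

∣foldr-gcd : ∀ {A : Set} (f : A → ℕ) {d} xs → (∀ {x} → x ∈ xs → d ∣ f x) →
             d ∣ foldr gcd 0 (map f xs)
∣foldr-gcd f {d} []       d∣f = d ∣0
∣foldr-gcd f     (y ∷ ys) d∣f = gcd-greatest (d∣f (here refl)) (∣foldr-gcd f ys (d∣f ∘ there))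

G∣C : ∀ {N m k} → 0 < k → k < N → m ∣ k → G N m ∣ N C k
G∣C {N} {m} 0<k k<N m∣k =
  foldr-gcd∣ (N C_) (∈-filter⁺ (λ j → (0 <? j) ×-dec (m ∣? j)) (∈-upTo⁺ k<N) (0<k , m∣k))

∣G : ∀ {N m d} → (∀ {k} → 0 < k → k < N → m ∣ k → d ∣ N C k) → d ∣ G N m
∣G {N} {m} d∣C = ∣foldr-gcd (N C_) (indices N m) λ k∈ →
  let k∈upTo , 0<k , m∣k = ∈-filter⁻ (λ j → (0 <? j) ×-dec (m ∣? j)) k∈
  in d∣C 0<k (∈-upTo⁻ k∈upTo) m∣k

^-monoʳ-∣ : ∀ m {i j} → i ≤ j → m ^ i ∣ m ^ j
^-monoʳ-∣ m {i} {j} i≤j =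
  divides (m ^ (j ∸ i)) (trans (cong (m ^_) (sym (m∸n+n≡m i≤j))) (^-distribˡ-+-* m (j ∸ i) i))

greatestExponent-unique : ∀ {p x e} → p ^ e ∣ x → ¬ p ^ suc e ∣ x →
                          ∀ b → e ≤ b → greatestExponent p x b ≡ e
greatestExponent-unique             pᵉ∣x pᵉ⁺¹∤x zero    z≤n = refl
greatestExponent-unique {p} {x} {e} pᵉ∣x pᵉ⁺¹∤x (suc b) e≤1+b with m≤n⇒m<n∨m≡n e≤1+b
... | inj₂ refl rewrite dec-true (p ^ suc b ∣? x) pᵉ∣x = refl
... | inj₁ (s≤s e≤b)
  rewrite dec-false (p ^ suc b ∣? x) (pᵉ⁺¹∤x ∘ ∣-trans (^-monoʳ-∣ p (s≤s e≤b)))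
  = greatestExponent-unique pᵉ∣x pᵉ⁺¹∤x b e≤b

n<m^n : ∀ {m} → 1 < m → ∀ n → n < m ^ n
n<m^n     1<m zero    = s≤s z≤n
n<m^n {m} 1<m (suc n) = begin-strict
  suc n       ≤⟨ n<m^n 1<m n ⟩
  m ^ n       <⟨ ^-monoʳ-< m 1<m (n<1+n n) ⟩
  m ^ suc n   ∎
  where open ≤-Reasoning

-- The search bound `x` is large enough because `e < p ^ e ≤ x`; every power divides 0, so `x = 0`
-- contradicts the last hypothesis.
v-unique : ∀ {p x e} → 1 < p → p ^ e ∣ x → ¬ p ^ suc e ∣ x → v p x ≡ e
v-unique {p} {zero}  {e} _   pᵉ∣x pᵉ⁺¹∤x = contradiction ((p ^ suc e) ∣0) pᵉ⁺¹∤x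
v-unique {p} {suc x} {e} 1<p pᵉ∣x pᵉ⁺¹∤x =
  greatestExponent-unique pᵉ∣x pᵉ⁺¹∤x (suc x) (≤-trans (<⇒≤ (n<m^n 1<p e)) (∣⇒≤ pᵉ∣x))

-- Addition in base `p` with counted carries.

-- The first index is the incoming carry, and the last one counts the carries
-- that are produced.

data Addition {p : ℕ} : ℕ → (ks ls ds : Expansion p) → ℕ → Set where
  done  : Addition 0 [] [] [] 0
  plain : ∀ {c s t d ks ls ds e} → toℕ s + toℕ t + c ≡ toℕ d →
          Addition 0 ks ls ds e → Addition c (s ∷ ks) (t ∷ ls) (d ∷ ds) e
  carry : ∀ {c s t d ks ls ds e} → toℕ s + toℕ t + c ≡ toℕ d + p →
          Addition 1 ks ls ds e → Addition c (s ∷ ks) (t ∷ ls) (d ∷ ds) (suc e)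

-- The expansions stand for k and N - k; positivity of the second one expresses k < N.
Proper : ∀ {p} → ℕ → (ks ls : Expansion p) → Set
Proper m ks ls = m ∣ fromDigits ks × 0 < fromDigits ks × 0 < fromDigits ls

addition-sound : ∀ {p c e} {ks ls ds : Expansion p} → Addition c ks ls ds e →
                 fromDigits ks + fromDigits ls + c ≡ fromDigits ds
addition-sound done = refl
addition-sound {p} {c} (plain {s = s} {t} {d} {ks} {ls} {ds} eq add) = begin
  toℕ s + k * p + (toℕ t + l * p) + c    ≡⟨ rearrange (toℕ s) (toℕ t) c k l p ⟩
  toℕ s + toℕ t + c + (k + l + 0) * p    ≡⟨ cong₂ (λ x y → x + y * p) eq (addition-sound add) ⟩
  toℕ d + fromDigits ds * p              ∎
  where
  open ≡-Reasoning
  k = fromDigits ks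
  l = fromDigits ls
  rearrange : ∀ s t c k l p → s + k * p + (t + l * p) + c ≡ s + t + c + (k + l + 0) * p
  rearrange = solve-∀
addition-sound {p} {c} (carry {s = s} {t} {d} {ks} {ls} {ds} eq add) = begin
  toℕ s + k * p + (toℕ t + l * p) + c    ≡⟨ rearrange (toℕ s) (toℕ t) c k l p ⟩
  toℕ s + toℕ t + c + (k + l) * p        ≡⟨ cong (_+ (k + l) * p) eq ⟩
  toℕ d + p + (k + l) * p                ≡⟨ regroup (toℕ d) k l p ⟩
  toℕ d + (k + l + 1) * p                ≡⟨ cong (λ y → toℕ d + y * p) (addition-sound add) ⟩
  toℕ d + fromDigits ds * p              ∎
  where
  open ≡-Reasoning
  k = fromDigits ks
  l = fromDigits ls
  rearrange : ∀ s t c k l p → s + k * p + (t + l * p) + c ≡ s + t + c + (k + l) * p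
  rearrange = solve-∀
  regroup : ∀ d k l p → d + p + (k + l) * p ≡ d + (k + l + 1) * p
  regroup = solve-∀

divMod-unique : ∀ {p r s a b} .{{_ : NonZero p}} → r < p → s < p →
                r + a * p ≡ s + b * p → r ≡ s × a ≡ b
divMod-unique {p} {r} {s} {a} {b} r<p s<p eq = r≡s ,
  *-cancelʳ-≡ a b p (+-cancelˡ-≡ s _ _ (trans (cong (_+ a * p) (sym r≡s)) eq))
  where
  open ≡-Reasoning
  r≡s : r ≡ s
  r≡s = begin
    r               ≡⟨ m<n⇒m%n≡m r<p ⟨
    r % p           ≡⟨ [m+kn]%n≡m%n r a p ⟨
    (r + a * p) % p ≡⟨ cong (_% p) eq ⟩
    (s + b * p) % p ≡⟨ [m+kn]%n≡m%n s b p ⟩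
    s % p           ≡⟨ m<n⇒m%n≡m s<p ⟩
    s               ∎

-- Long addition: division by `p` yields the lowest digits of `k` and `l`, and uniqueness of
-- division identifies the lowest digit of their sum with that of `ds`. The bound `c ≤ 1` keeps each
-- column below `p + p`, so the outgoing carry is again at most 1.
addition-complete : ∀ {p} .{{_ : NonZero p}} (ds : Expansion p) {c} k l → c ≤ 1 →
                    k + l + c ≡ fromDigits ds →
                    ∃ λ ks → ∃ λ ls → ∃ λ e →
                    Addition c ks ls ds e × fromDigits ks ≡ k × fromDigits ls ≡ l
addition-complete []           zero zero c≤1 refl = [] , [] , 0 , done , refl , refl
addition-complete {p} (d ∷ ds) {c} k l c≤1 eq
  with k divMod p | l divMod p
... | result k′ s refl | result l′ t refl with toℕ s + toℕ t + c <? p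
... | yes small =
  let d≡ , ds≡ = divMod-unique small (toℕ<n d) (trans (sym (rearrange (toℕ s) (toℕ t) c k′ l′ p)) eq)
      ks , ls , e , add , k≡ , l≡ = addition-complete ds k′ l′ z≤n ds≡
  in s ∷ ks , t ∷ ls , e , plain d≡ add
     , cong (λ x → toℕ s + x * p) k≡ , cong (λ x → toℕ t + x * p) l≡
  where
  rearrange : ∀ s t c k l p → s + k * p + (t + l * p) + c ≡ s + t + c + (k + l + 0) * p
  rearrange = solve-∀
... | no ¬small =
  let r = toℕ s + toℕ t + c ∸ p
      r+p≡ : r + p ≡ toℕ s + toℕ t + c
      r+p≡ = m∸n+n≡m (≮⇒≥ ¬small)
      r<p : r < p
      r<p = +-cancelʳ-< p r p (begin-strict
        r + p                  ≡⟨ r+p≡ ⟩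
        toℕ s + toℕ t + c      ≤⟨ +-monoʳ-≤ (toℕ s + toℕ t) c≤1 ⟩
        toℕ s + toℕ t + 1      ≡⟨ +-comm (toℕ s + toℕ t) 1 ⟩
        suc (toℕ s) + toℕ t    <⟨ +-mono-≤-< (toℕ<n s) (toℕ<n t) ⟩
        p + p                  ∎)
      d≡ , ds≡ = divMod-unique r<p (toℕ<n d) (trans (rearrange r k′ l′ p)
        (trans (cong (_+ (k′ + l′) * p) r+p≡)
        (trans (sym (regroup (toℕ s) (toℕ t) c k′ l′ p)) eq)))
      ks , ls , e , add , k≡ , l≡ = addition-complete ds k′ l′ ≤-refl ds≡
  in s ∷ ks , t ∷ ls , suc e , carry (trans (sym r+p≡) (cong (_+ p) d≡)) add
     , cong (λ x → toℕ s + x * p) k≡ , cong (λ x → toℕ t + x * p) l≡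
  where
  open ≤-Reasoning
  rearrange : ∀ r k l p → r + (k + l + 1) * p ≡ r + p + (k + l) * p
  rearrange = solve-∀
  regroup : ∀ s t c k l p → s + k * p + (t + l * p) + c ≡ s + t + c + (k + l) * p
  regroup = solve-∀

-- Kummer's theorem, by way of factorials.

module _ {p : ℕ} (p-prime : Prime p) where

  private
    instance
      p≢0 : NonZero p
      p≢0 = prime⇒nonZero p-prime

  p∤1 : ¬ p ∣ 1
  p∤1 = >⇒∤ (nonTrivial⇒n>1 p {{prime⇒nonTrivial p-prime}})

  ∤-* : ∀ {a b} → ¬ p ∣ a → ¬ p ∣ b → ¬ p ∣ a * b
  ∤-* {a} {b} p∤a p∤b p∣ab = [ p∤a , p∤b ]′ (euclidsLemma a b p-prime p∣ab)

  -- Among the factors of the factorial, the multiples of `p` are p, 2p, ..., qp, with product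
  -- `p ^ q * q !`; the others are prime to `p` and make up `u`.
  factorial-unit : ∀ q r → r < p → ∃ λ u → ¬ p ∣ u × (r + q * p) ! ≡ p ^ q * q ! * u
  factorial-unit zero    zero    r<p = 1 , p∤1 , refl
  factorial-unit (suc q) zero    r<p =
    let u , p∤u , eq = factorial-unit q (pred p) (≤-reflexive (suc-pred p))
    in u , p∤u , (begin
      (p + q * p) !                            ≡⟨ cong (λ x → (x + q * p) !) (suc-pred p) ⟨
      (suc (pred p) + q * p) * (pred p + q * p) ! ≡⟨ cong₂ (λ x y → (x + q * p) * y) (suc-pred p) eq ⟩
      (p + q * p) * (p ^ q * q ! * u)          ≡⟨ rearrange p q (p ^ q) (q !) u ⟩
      p * p ^ q * (suc q * q !) * u            ∎)
    where
    open ≡-Reasoning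
    rearrange : ∀ p q x y u → (p + q * p) * (x * y * u) ≡ p * x * (suc q * y) * u
    rearrange = solve-∀
  factorial-unit q       (suc r) r<p =
    let u , p∤u , eq = factorial-unit q r (<⇒≤ r<p)
    in (suc r + q * p) * u
     , ∤-* (λ p∣ → >⇒∤ r<p (∣m+n∣m⇒∣n (subst (p ∣_) (+-comm (suc r) (q * p)) p∣) (n∣m*n q))) p∤u
     , trans (cong ((suc r + q * p) *_) eq) (rearrange (suc r + q * p) (p ^ q * q !) u)
    where
    rearrange : ∀ a x u → a * (x * u) ≡ x * (a * u)
    rearrange = solve-∀

  -- Kummer's theorem with the parts prime to `p` collected in `u` and `w`, so that nothing is
  -- divided. Removing the lowest digits takes out `p ^ n`, `p ^ k` and `p ^ l`, where `n` is
  -- `k + l` plus the outgoing carry, so each carry contributes exactly one factor `p`.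
  factorial-carries : ∀ {c e} {ks ls ds : Expansion p} → Addition c ks ls ds e →
    ∃₂ λ u w → ¬ p ∣ u × ¬ p ∣ w ×
      fromDigits ds ! * u ≡ p ^ e * w * (fromDigits ks ! * fromDigits ls !)
  factorial-carries done = 1 , 1 , p∤1 , p∤1 , refl
  factorial-carries (plain {s = s} {t} {d} {ks} {ls} {ds} {e} _ add) =
    let u , w , p∤u , p∤w , ih = factorial-carries add
        u₁ , p∤u₁ , eq₁ = factorial-unit (fromDigits ds) (toℕ d) (toℕ<n d)
        u₂ , p∤u₂ , eq₂ = factorial-unit (fromDigits ks) (toℕ s) (toℕ<n s)
        u₃ , p∤u₃ , eq₃ = factorial-unit (fromDigits ls) (toℕ t) (toℕ<n t)
        k = fromDigits ks
        l = fromDigits ls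
        n = fromDigits ds
    in u * (u₂ * u₃) , w * u₁ , ∤-* p∤u (∤-* p∤u₂ p∤u₃) , ∤-* p∤w p∤u₁ , (begin
      (toℕ d + n * p) ! * (u * (u₂ * u₃))
        ≡⟨ cong (_* (u * (u₂ * u₃))) eq₁ ⟩
      p ^ n * n ! * u₁ * (u * (u₂ * u₃))
        ≡⟨ regroup (p ^ n) (n !) u₁ u (u₂ * u₃) ⟩
      p ^ n * (n ! * u) * (u₁ * (u₂ * u₃))
        ≡⟨ cong₂ (λ x y → x * y * (u₁ * (u₂ * u₃)))
             (trans (cong (p ^_) (trans (sym (addition-sound add)) (+-identityʳ (k + l))))
                    (^-distribˡ-+-* p k l)) ih ⟩
      p ^ k * p ^ l * (p ^ e * w * (k ! * l !)) * (u₁ * (u₂ * u₃))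
        ≡⟨ distribute (p ^ k) (p ^ l) (p ^ e) w (k !) (l !) u₁ u₂ u₃ ⟩
      p ^ e * (w * u₁) * (p ^ k * k ! * u₂ * (p ^ l * l ! * u₃))
        ≡⟨ cong₂ (λ x y → p ^ e * (w * u₁) * (x * y)) eq₂ eq₃ ⟨
      p ^ e * (w * u₁) * ((toℕ s + k * p) ! * (toℕ t + l * p) !) ∎)
    where
    open ≡-Reasoning
    regroup : ∀ a b c d f → a * b * c * (d * f) ≡ a * (b * d) * (c * f)
    regroup = solve-∀
    distribute : ∀ P Q E w K L x y z →
      P * Q * (E * w * (K * L)) * (x * (y * z)) ≡ E * (w * x) * (P * K * y * (Q * L * z))
    distribute = solve-∀
  factorial-carries (carry {s = s} {t} {d} {ks} {ls} {ds} {e} _ add) =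
    let u , w , p∤u , p∤w , ih = factorial-carries add
        u₁ , p∤u₁ , eq₁ = factorial-unit (fromDigits ds) (toℕ d) (toℕ<n d)
        u₂ , p∤u₂ , eq₂ = factorial-unit (fromDigits ks) (toℕ s) (toℕ<n s)
        u₃ , p∤u₃ , eq₃ = factorial-unit (fromDigits ls) (toℕ t) (toℕ<n t)
        k = fromDigits ks
        l = fromDigits ls
        n = fromDigits ds
    in u * (u₂ * u₃) , w * u₁ , ∤-* p∤u (∤-* p∤u₂ p∤u₃) , ∤-* p∤w p∤u₁ , (begin
      (toℕ d + n * p) ! * (u * (u₂ * u₃))
        ≡⟨ cong (_* (u * (u₂ * u₃))) eq₁ ⟩
      p ^ n * n ! * u₁ * (u * (u₂ * u₃))
        ≡⟨ regroup (p ^ n) (n !) u₁ u (u₂ * u₃) ⟩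
      p ^ n * (n ! * u) * (u₁ * (u₂ * u₃))
        ≡⟨ cong₂ (λ x y → x * y * (u₁ * (u₂ * u₃)))
             (trans (cong (p ^_) (trans (sym (addition-sound add)) (+-comm (k + l) 1)))
                    (cong (p *_) (^-distribˡ-+-* p k l))) ih ⟩
      p * (p ^ k * p ^ l) * (p ^ e * w * (k ! * l !)) * (u₁ * (u₂ * u₃))
        ≡⟨ distribute p (p ^ k) (p ^ l) (p ^ e) w (k !) (l !) u₁ u₂ u₃ ⟩
      p * p ^ e * (w * u₁) * (p ^ k * k ! * u₂ * (p ^ l * l ! * u₃))
        ≡⟨ cong₂ (λ x y → p * p ^ e * (w * u₁) * (x * y)) eq₂ eq₃ ⟨
      p * p ^ e * (w * u₁) * ((toℕ s + k * p) ! * (toℕ t + l * p) !) ∎)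
    where
    open ≡-Reasoning
    regroup : ∀ a b c d f → a * b * c * (d * f) ≡ a * (b * d) * (c * f)
    regroup = solve-∀
    distribute : ∀ p P Q E w K L x y z →
      p * (P * Q) * (E * w * (K * L)) * (x * (y * z)) ≡ p * E * (w * x) * (P * K * y * (Q * L * z))
    distribute = solve-∀

  ^∣*⇒^∣ : ∀ e {x u} → ¬ p ∣ u → p ^ e ∣ x * u → p ^ e ∣ x
  ^∣*⇒^∣ zero    {x}     p∤u _    = 1∣ x
  ^∣*⇒^∣ (suc e) {x} {u} p∤u pᵉ∣xu
    with euclidsLemma x u p-prime (∣-trans (m∣m*n (p ^ e)) pᵉ∣xu)
  ... | inj₂ p∣u = contradiction p∣u p∤u
  ... | inj₁ (divides y refl) =
    subst (p * p ^ e ∣_) (*-comm p y)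
      (*-monoʳ-∣ p (^∣*⇒^∣ e p∤u (*-cancelˡ-∣ p (subst (p * p ^ e ∣_) (rearrange y p u) pᵉ∣xu))))
    where
    rearrange : ∀ y p u → y * p * u ≡ p * (y * u)
    rearrange = solve-∀

  C-factorial : ∀ k l → ((k + l) C k) * (k ! * l !) ≡ (k + l) !
  C-factorial k l = begin
    ((k + l) C k) * (k ! * l !)             ≡⟨ cong (λ x → ((k + l) C k) * (k ! * x !)) (m+n∸m≡n k l) ⟨
    ((k + l) C k) * (k ! * (k + l ∸ k) !)   ≡⟨ cong (_* (k ! * (k + l ∸ k) !)) (nCk≡n!/k![n-k]! (m≤m+n k l)) ⟩
    _                                       ≡⟨ m/n*n≡m (subst (_∣ (k + l) !) (*-comm ((k + l ∸ k) !) (k !))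
                                                 ([n∸k]!k!∣n! (m≤m+n k l))) ⟩
    (k + l) !                               ∎
    where
    open ≡-Reasoning
    instance _ = k !* (k + l ∸ k) !≢0

  C-carries : ∀ {e} {ks ls ds : Expansion p} → Addition 0 ks ls ds e →
              ∃₂ λ u w → ¬ p ∣ u × ¬ p ∣ w ×
                (fromDigits ds C fromDigits ks) * u ≡ p ^ e * w
  C-carries {e} {ks} {ls} {ds} add =
    let u , w , p∤u , p∤w , eq = factorial-carries add
        k = fromDigits ks
        l = fromDigits ls
        n = fromDigits ds
        n≡ : n ≡ k + l
        n≡ = trans (sym (addition-sound add)) (+-identityʳ (k + l))
        instance _ = k !* l !≢0
    in u , w , p∤u , p∤w , *-cancelʳ-≡ _ _ (k ! * l !) (begin
      (n C k) * u * (k ! * l !)           ≡⟨ rearrange (n C k) u (k ! * l !) ⟩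
      (n C k) * (k ! * l !) * u           ≡⟨ cong (λ x → (x C k) * (k ! * l !) * u) n≡ ⟩
      ((k + l) C k) * (k ! * l !) * u   ≡⟨ cong (_* u) (C-factorial k l) ⟩
      (k + l) ! * u                     ≡⟨ cong (λ x → x ! * u) n≡ ⟨
      n ! * u                           ≡⟨ eq ⟩
      p ^ e * w * (k ! * l !)           ∎)
    where
    open ≡-Reasoning
    rearrange : ∀ c u f → c * u * f ≡ c * f * u
    rearrange = solve-∀

  ^carries∣C : ∀ {e} {ks ls ds : Expansion p} → Addition 0 ks ls ds e →
               p ^ e ∣ fromDigits ds C fromDigits ks
  ^carries∣C {e} add =
    let u , w , p∤u , p∤w , eq = C-carries add
    in ^∣*⇒^∣ e p∤u (divides w (trans eq (*-comm (p ^ e) w)))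

  ^suc-carries∤C : ∀ {e} {ks ls ds : Expansion p} → Addition 0 ks ls ds e →
                   ¬ p ^ suc e ∣ fromDigits ds C fromDigits ks
  ^suc-carries∤C {e} add pᵉ⁺¹∣C =
    let u , w , p∤u , p∤w , eq = C-carries add
        instance _ = m^n≢0 p e
    in p∤w (*-cancelˡ-∣ (p ^ e)
         (subst₂ _∣_ (*-comm p (p ^ e)) eq (∣m⇒∣m*n u pᵉ⁺¹∣C)))

-- Even and odd digit sums, modulo `p + 1` and under addition.

-- Since p² - 1 is a multiple of p + 1, each digit counts modulo p + 1 as if it
-- stood at position 0 or 1.
fromDigits-mod : ∀ {p} .{{_ : NonZero p}} (ds : Expansion p) →
  ∃ λ t → fromDigits ds ≡ evenDigitSum ds + oddDigitSum ds * p + t * (p + 1)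
fromDigits-mod []       = 0 , refl
fromDigits-mod {p@(suc q)} (d ∷ ds) =
  let t , eq = fromDigits-mod ds
      a = evenDigitSum ds
      b = oddDigitSum ds
  in b * q + t * p , trans (cong (λ x → toℕ d + x * p) eq) (rearrange (toℕ d) a b t q)
  where
  rearrange : ∀ d a b t q → d + (a + b * suc q + t * (suc q + 1)) * suc q ≡
              d + b + a * suc q + (b * q + t * suc q) * (suc q + 1)
  rearrange = solve-∀

-- Since `p` is -1 modulo `m`, the number `evenDigitSum ds + oddDigitSum ds * p` represents the
-- difference of the digit sums without a subtraction.
∣fromDigits⇒∣digitSums : ∀ {m p} .{{_ : NonZero p}} (ds : Expansion p) → m ∣ p + 1 →
  m ∣ fromDigits ds → m ∣ evenDigitSum ds + oddDigitSum ds * p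
∣fromDigits⇒∣digitSums {m} {p} ds m∣p+1 m∣ds =
  let t , eq = fromDigits-mod ds
  in ∣m+n∣m⇒∣n (subst (m ∣_) (trans eq (+-comm _ (t * (p + 1)))) m∣ds) (∣n⇒∣m*n t m∣p+1)

∣digitSums⇒∣fromDigits : ∀ {m p} .{{_ : NonZero p}} (ds : Expansion p) → m ∣ p + 1 →
  m ∣ evenDigitSum ds + oddDigitSum ds * p → m ∣ fromDigits ds
∣digitSums⇒∣fromDigits {m} {p} ds m∣p+1 m∣sums =
  let t , eq = fromDigits-mod ds
  in subst (m ∣_) (sym eq) (∣m∣n⇒∣m+n m∣sums (∣n⇒∣m*n t m∣p+1))

digitSums≤fromDigits : ∀ {p} .{{_ : NonZero p}} (ds : Expansion p) →
  evenDigitSum ds + oddDigitSum ds ≤ fromDigits ds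
digitSums≤fromDigits {p} ds = let t , eq = fromDigits-mod ds in begin
  evenDigitSum ds + oddDigitSum ds                      ≤⟨ +-monoʳ-≤ (evenDigitSum ds) (m≤m*n (oddDigitSum ds) p) ⟩
  evenDigitSum ds + oddDigitSum ds * p                  ≤⟨ m≤m+n _ _ ⟩
  evenDigitSum ds + oddDigitSum ds * p + t * (p + 1)    ≡⟨ eq ⟨
  fromDigits ds                                         ∎
  where open ≤-Reasoning

digitSums≡0⇒fromDigits≡0 : ∀ {p} (ds : Expansion p) →
  evenDigitSum ds ≡ 0 → oddDigitSum ds ≡ 0 → fromDigits ds ≡ 0
digitSums≡0⇒fromDigits≡0 []       _  _  = refl
digitSums≡0⇒fromDigits≡0 {p} (d ∷ ds) ≡₁ ≡₂ =
  cong₂ (λ x y → x + y * p) (m+n≡0⇒m≡0 (toℕ d) ≡₁)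
        (digitSums≡0⇒fromDigits≡0 ds ≡₂ (m+n≡0⇒n≡0 (toℕ d) ≡₁))

-- The incoming carry enters at position 0 and so counts with the even positions; the tail receives
-- no carry, and there the two sums exchange roles.
digitSums-noCarry : ∀ {p c e} {ks ls ds : Expansion p} → Addition c ks ls ds e → e ≡ 0 →
  evenDigitSum ks + evenDigitSum ls + c ≡ evenDigitSum ds ×
  oddDigitSum ks + oddDigitSum ls ≡ oddDigitSum ds
digitSums-noCarry done _ = refl , refl
digitSums-noCarry {c = c} (plain {s = s} {t} {d} {ks} {ls} eq add) e≡0 =
  let even≡ , odd≡ = digitSums-noCarry add e≡0
  in trans (rearrange (toℕ s) (toℕ t) c (oddDigitSum ks) (oddDigitSum ls)) (cong₂ _+_ eq odd≡)
   , trans (sym (+-identityʳ _)) even≡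
  where
  rearrange : ∀ s t c k l → s + k + (t + l) + c ≡ s + t + c + (k + l)
  rearrange = solve-∀

-- The only carry leaves a position of one parity, where the summands have `p` too much, and enters
-- one of the other parity, where they have 1 too little. The first alternative is a carry out of an
-- even position.
digitSums-oneCarry : ∀ {p c e} {ks ls ds : Expansion p} → Addition c ks ls ds e → e ≡ 1 →
  (evenDigitSum ks + evenDigitSum ls + c ≡ evenDigitSum ds + p ×
   oddDigitSum ks + oddDigitSum ls + 1 ≡ oddDigitSum ds) ⊎
  (evenDigitSum ks + evenDigitSum ls + c + 1 ≡ evenDigitSum ds ×
   oddDigitSum ks + oddDigitSum ls ≡ oddDigitSum ds + p)
digitSums-oneCarry {p} {c} (plain {s = s} {t} {d} {ks} {ls} {ds} eq add) e≡1
  with digitSums-oneCarry add e≡1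
... | inj₁ (even≡ , odd≡) = inj₂
  ( trans (rearrange (toℕ s) (toℕ t) c (oddDigitSum ks) (oddDigitSum ls)) (cong₂ _+_ eq odd≡)
  , trans (sym (+-identityʳ _)) even≡ )
  where
  rearrange : ∀ s t c k l → s + k + (t + l) + c + 1 ≡ s + t + c + (k + l + 1)
  rearrange = solve-∀
... | inj₂ (even≡ , odd≡) = inj₁
  ( trans (rearrange (toℕ s) (toℕ t) c (oddDigitSum ks) (oddDigitSum ls))
      (trans (cong₂ _+_ eq odd≡) (sym (+-assoc (toℕ d) _ p)))
  , trans (regroup (evenDigitSum ks) (evenDigitSum ls)) even≡ )
  where
  rearrange : ∀ s t c k l → s + k + (t + l) + c ≡ s + t + c + (k + l)
  rearrange = solve-∀
  regroup : ∀ k l → k + l + 1 ≡ k + l + 0 + 1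
  regroup = solve-∀
digitSums-oneCarry {p} {c} (carry {s = s} {t} {d} {ks} {ls} {ds} eq add) e≡1 =
  let even≡ , odd≡ = digitSums-noCarry add (suc-injective e≡1)
  in inj₁
  ( trans (rearrange (toℕ s) (toℕ t) c (oddDigitSum ks) (oddDigitSum ls))
      (trans (cong₂ _+_ eq odd≡) (regroup (toℕ d) p (oddDigitSum ds)))
  , even≡ )
  where
  rearrange : ∀ s t c k l → s + k + (t + l) + c ≡ s + t + c + (k + l)
  rearrange = solve-∀
  regroup : ∀ d p n → d + p + n ≡ d + n + p
  regroup = solve-∀

-- Shows that a summand with digit sums (1 , 1) is admissible, in the form `a + b * p` that
-- `witness` asks for.
∣p+1⇒∣1+1*p : ∀ {m p} → m ∣ p + 1 → m ∣ 1 + 1 * p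
∣p+1⇒∣1+1*p {m} {p} = subst (m ∣_) (trans (+-comm p 1) (cong suc (sym (*-identityˡ p))))

-- Additions with prescribed digit sums.

-- Digit sums decide divisibility by `m` and positivity of both summands, so additions are built to
-- prescribed values of them.
record Decomposition {p : ℕ} (c : ℕ) (ds : Expansion p) (e a b a′ b′ : ℕ) : Set where
  field
    {ks ls}  : Expansion p
    addition : Addition c ks ls ds e
    even-ks  : evenDigitSum ks ≡ a
    odd-ks   : oddDigitSum ks ≡ b
    even-ls  : evenDigitSum ls ≡ a′
    odd-ls   : oddDigitSum ls ≡ b′

open Decomposition

plainᵈ : ∀ {p c d e a b a′ b′} {ds : Expansion p} (s t : Fin p) → toℕ s + toℕ t + c ≡ toℕ d →
  Decomposition 0 ds e a b a′ b′ → Decomposition c (d ∷ ds) e (toℕ s + b) a (toℕ t + b′) a′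
plainᵈ s t eq D = record
  { addition = plain eq (addition D)
  ; even-ks = cong (toℕ s +_) (odd-ks D) ; odd-ks = even-ks D
  ; even-ls = cong (toℕ t +_) (odd-ls D) ; odd-ls = even-ls D }

carryᵈ : ∀ {p c d e a b a′ b′} {ds : Expansion p} (s t : Fin p) → toℕ s + toℕ t + c ≡ toℕ d + p →
  Decomposition 1 ds e a b a′ b′ → Decomposition c (d ∷ ds) (suc e) (toℕ s + b) a (toℕ t + b′) a′
carryᵈ s t eq D = record
  { addition = carry eq (addition D)
  ; even-ks = cong (toℕ s +_) (odd-ks D) ; odd-ks = even-ks D
  ; even-ls = cong (toℕ t +_) (odd-ls D) ; odd-ls = even-ls D }

-- Lowering the lowest digit by one leaves room for an incoming carry; the summands stay the same.
absorbCarry : ∀ {p a b a′ b′} {d : Fin p} {ds : Expansion (suc p)} →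
  Decomposition 0 (inject₁ d ∷ ds) 0 a b a′ b′ → Decomposition 1 (suc d ∷ ds) 0 a b a′ b′
absorbCarry {d = d} record
  { addition = plain {s = s} {t} eq add
  ; even-ks = α ; odd-ks = β ; even-ls = γ ; odd-ls = δ } = record
  { addition = plain (trans (shift (toℕ s) (toℕ t)) (cong suc (trans eq (toℕ-inject₁ d)))) add
  ; even-ks = α ; odd-ks = β ; even-ls = γ ; odd-ls = δ }
  where
  shift : ∀ s t → s + t + 1 ≡ suc (s + t + 0)
  shift = solve-∀

-- A two by two array with row sums `d`, `x` and column sums `a`, `a′`, filled greedily: `s` is the
-- minimum of `a` and `d`.
+-refine : ∀ {a a′} d x → a + a′ ≡ d + x →
  ∃₂ λ s t → ∃₂ λ u w → s + t ≡ d × u + w ≡ x × s + u ≡ a × t + w ≡ a′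
+-refine {a} {a′} d x eq with ≤-total a d
... | inj₁ a≤d = a , d ∸ a , 0 , x , m+[n∸m]≡n a≤d , refl , +-identityʳ a ,
  +-cancelˡ-≡ a _ _ (trans (sym (+-assoc a _ x)) (trans (cong (_+ x) (m+[n∸m]≡n a≤d)) (sym eq)))
... | inj₂ d≤a = d , 0 , a ∸ d , a′ , +-identityʳ d ,
  +-cancelˡ-≡ d _ _ (trans (sym (+-assoc d _ a′)) (trans (cong (_+ a′) (m+[n∸m]≡n d≤a)) eq)) ,
  m+[n∸m]≡n d≤a , refl

-- The prescribed sums are distributed over the digits from the lowest position on; both parts of a
-- digit are at most that digit, so no carry arises.
splitDigits : ∀ {p} (ds : Expansion p) {a a′ b b′} →
  a + a′ ≡ evenDigitSum ds → b + b′ ≡ oddDigitSum ds → Decomposition 0 ds 0 a b a′ b′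
splitDigits [] {zero} {zero} {zero} {zero} refl refl = record
  { addition = done ; even-ks = refl ; odd-ks = refl ; even-ls = refl ; odd-ls = refl }
splitDigits {p} (d ∷ ds) {a} {a′} eq₁ eq₂ with +-refine {a} {a′} (toℕ d) (oddDigitSum ds) eq₁
... | s , t , u , w , s+t≡d , u+w≡ , refl , refl =
  subst₂ (λ x y → Decomposition 0 (d ∷ ds) 0 (x + u) _ (y + w) _) (toℕ-fromℕ< s<p) (toℕ-fromℕ< t<p)
    (plainᵈ (fromℕ< s<p) (fromℕ< t<p)
      (trans (+-identityʳ _) (trans (cong₂ _+_ (toℕ-fromℕ< s<p) (toℕ-fromℕ< t<p)) s+t≡d))
      (splitDigits ds eq₂ u+w≡))
  where
  s<p : s < p
  s<p = ≤-<-trans (≤-trans (m≤m+n s t) (≤-reflexive s+t≡d)) (toℕ<n d)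
  t<p : t < p
  t<p = ≤-<-trans (≤-trans (m≤n+m t s) (≤-reflexive s+t≡d)) (toℕ<n d)

-- Admissible summands with one or two carries.

module _ {q : ℕ} where

  private
    p : ℕ
    p = 2+ q

    one : Fin p
    one = suc zero

    p-1 : Fin p
    p-1 = fromℕ (suc q)

    p-2 : Fin p
    p-2 = inject₁ (fromℕ q)

    toℕ-p-1 : toℕ p-1 ≡ suc q
    toℕ-p-1 = toℕ-fromℕ (suc q)

    toℕ-p-2 : toℕ p-2 ≡ q
    toℕ-p-2 = trans (toℕ-inject₁ (fromℕ q)) (toℕ-fromℕ q)

  -- The lowest non-zero digit, which sits at an odd position, lends to the
  -- position before it.
  borrow : (ds : Expansion p) {x y : Fin p} → toℕ x + toℕ y ≡ p → ∀ {a a′} →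
    evenDigitSum ds ≡ 0 → oddDigitSum ds ≡ suc (a + a′) →
    Decomposition 0 ds 1 (toℕ x) a (toℕ y) a′
  borrow (zero ∷ zero ∷ ds) x+y≡p eq₁ eq₂ =
    plainᵈ zero zero refl (plainᵈ zero zero refl (borrow ds x+y≡p eq₁ eq₂))
  borrow (zero ∷ suc d ∷ ds) {x} {y} x+y≡p eq₁ eq₂ =
    subst₂ (λ i j → Decomposition 0 _ 1 i _ j _) (+-identityʳ (toℕ x)) (+-identityʳ (toℕ y))
      (carryᵈ x y (trans (+-identityʳ _) x+y≡p)
        (absorbCarry (splitDigits (inject₁ d ∷ ds)
          (trans (sym (suc-injective eq₂)) (cong (_+ oddDigitSum ds) (sym (toℕ-inject₁ d)))) (sym eq₁))))

  Witness : ℕ → ℕ → Expansion p → Set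
  Witness m e ds = ∃₂ λ ks ls → Addition 0 ks ls ds e × Proper m ks ls

  prependZero : ∀ {m e ds} → Witness m e ds → Witness m e (zero ∷ ds)
  prependZero (ks , ls , add , m∣k , 0<k , 0<l) = zero ∷ ks , zero ∷ ls , plain refl add
    , ∣m⇒∣m*n p m∣k , *-mono-< 0<k (s≤s (z≤n {suc q})) , *-mono-< 0<l (s≤s (z≤n {suc q}))

  witness : ∀ {m e ds a b a′ b′} → m ∣ p + 1 → Decomposition 0 ds e a b a′ b′ →
    m ∣ a + b * p → 0 < a + b → 0 < a′ + b′ → Witness m e ds
  witness {m} m∣p+1 record { ks = ks ; ls = ls ; addition = add
    ; even-ks = refl ; odd-ks = refl ; even-ls = refl ; odd-ls = refl } m∣ 0<k 0<l =
    ks , ls , add , ∣digitSums⇒∣fromDigits ks m∣p+1 m∣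
    , <-≤-trans 0<k (digitSums≤fromDigits ks) , <-≤-trans 0<l (digitSums≤fromDigits ls)

  -- If the units digit is non-zero, the first summand takes 1 from it and 1 from the `p` that a
  -- higher digit lends to an odd position, which gives the digit sums (1 , 1).
  oneCarry-pureEven : ∀ {m} (ds : Expansion p) → m ∣ p + 1 → 2 ≤ m →
    evenDigitSum ds ≡ m → oddDigitSum ds ≡ 0 → m < fromDigits ds → Witness m 1 ds
  -- A borrow turns (0 , m) into (p , m - 1), from which the first summand takes (1 , 1).
  oneCarry-pureOdd : ∀ {m} (ds : Expansion p) → m ∣ p + 1 → 2 ≤ m →
    evenDigitSum ds ≡ 0 → oddDigitSum ds ≡ m → Witness m 1 ds

  private
    1+[p-1]≡p : toℕ one + toℕ p-1 ≡ p
    1+[p-1]≡p = cong suc toℕ-p-1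

  oneCarry-pureOdd ds m∣p+1 (s≤s (s≤s {n = m} _)) eq₁ eq₂ =
    witness m∣p+1 (borrow ds {one} {p-1} 1+[p-1]≡p {1} {m} eq₁ eq₂) (∣p+1⇒∣1+1*p m∣p+1)
      (s≤s z≤n) (s≤s z≤n)

  oneCarry-pureEven (zero ∷ ds) m∣p+1 2≤m eq₁ eq₂ m<N = prependZero (oneCarry-pureOdd ds m∣p+1 2≤m eq₂ eq₁)
  oneCarry-pureEven (suc d ∷ ds) m∣p+1 2≤m eq₁ eq₂ m<N with oddDigitSum ds in odd≡
  ... | suc n = witness m∣p+1
    (plainᵈ one (inject₁ d) (trans (+-identityʳ _) (cong suc (toℕ-inject₁ d)))
      (borrow ds {one} {p-1} 1+[p-1]≡p {0} {n} eq₂ odd≡))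
    (∣p+1⇒∣1+1*p m∣p+1) (s≤s z≤n)
    (≤-trans (s≤s z≤n) (m≤n+m (toℕ p-1) _))
  -- No higher digit is left to lend: the units digit alone is `m`, so the number would be `m`
  -- itself.
  ... | zero = contradiction m<N (≤⇒≯ (≤-reflexive (begin
    suc (toℕ d) + fromDigits ds * p  ≡⟨ cong (λ n → suc (toℕ d) + n * p) (digitSums≡0⇒fromDigits≡0 ds eq₂ odd≡) ⟩
    suc (toℕ d) + 0                  ≡⟨ eq₁ ⟩
    _                                ∎)))
    where open ≡-Reasoning

  -- The expansion has just two non-zero digits, both 1. The upper one lends `p` to the position
  -- below it, and there the first summand can have its only digit `m`, since `m < p`.
  oneCarry-11 : ∀ {m} (ds : Expansion p) → m ∣ p + 1 → 2 ≤ m → m < p →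
    evenDigitSum ds ≡ 1 → oddDigitSum ds ≡ 1 → Witness m 1 ds
  oneCarry-11 (zero ∷ ds) m∣p+1 2≤m m<p eq₁ eq₂ = prependZero (oneCarry-11 ds m∣p+1 2≤m m<p eq₂ eq₁)
  oneCarry-11 {m} (suc zero ∷ suc zero ∷ ds) m∣p+1 2≤m m<p eq₁ eq₂ =
    witness m∣p+1
      -- The digit 1 together with the borrowed `p` splits into `m` and `1 + p - m`.
      (carryᵈ (fromℕ< m<p) (fromℕ< y<p)
        (trans (+-identityʳ _) (trans (cong₂ _+_ (toℕ-fromℕ< m<p) (toℕ-fromℕ< y<p))
          (m+[n∸m]≡n (m≤n⇒m≤1+n (<⇒≤ m<p)))))
        (plainᵈ zero zero refl
          (splitDigits ds {0} {0} {0} {0} (sym (suc-injective eq₁)) (sym (suc-injective eq₂)))))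
      (subst (λ x → m ∣ x + 0 + 0) (sym (toℕ-fromℕ< m<p))
        (subst (m ∣_) (sym (trans (+-identityʳ _) (+-identityʳ m))) ∣-refl))
      (subst (λ x → 0 < x + 0 + 0) (sym (toℕ-fromℕ< m<p))
        (≤-trans (<⇒≤ 2≤m) (≤-trans (m≤m+n m 0) (m≤m+n _ 0))))
      (subst (λ x → 0 < x + 0 + 0) (sym (toℕ-fromℕ< y<p))
        (≤-trans (m<n⇒0<n∸m (m≤n⇒m≤1+n m<p)) (≤-trans (m≤m+n _ 0) (m≤m+n _ 0))))
    where
    y<p : 1 + p ∸ m < p
    y<p = s≤s (∸-monoʳ-≤ (1 + p) 2≤m)
  oneCarry-11 {m} (suc zero ∷ zero ∷ ds) m∣p+1 2≤m m<p eq₁ eq₂ =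
    witness m∣p+1
      (plainᵈ zero one refl (plainᵈ zero zero refl
        (borrow ds {fromℕ< m<p} {fromℕ< y<p}
          (trans (cong₂ _+_ (toℕ-fromℕ< m<p) (toℕ-fromℕ< y<p)) (m+[n∸m]≡n (<⇒≤ m<p)))
          {0} {0} (suc-injective eq₁) eq₂)))
      (subst (λ x → m ∣ x + 0) (sym (toℕ-fromℕ< m<p)) (subst (m ∣_) (sym (+-identityʳ m)) ∣-refl))
      (subst (λ x → 0 < x + 0) (sym (toℕ-fromℕ< m<p)) (≤-trans (<⇒≤ 2≤m) (m≤m+n m 0)))
      (s≤s z≤n)
    where
    y<p : p ∸ m < p
    y<p = ≤-trans (s≤s (∸-monoʳ-≤ p 2≤m)) (n≤1+n _)

  -- A 1 borrowed across two zero positions leaves `p` at the lower and `p - 1` at the upper one.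
  -- Taking 1 from each gives `p + 1` times a power of `p`. The prepended `zero` guarantees the
  -- lower position.
  twoCarries-borrow : (ds : Expansion p) → evenDigitSum ds ≡ 0 → oddDigitSum ds ≡ 1 →
    Decomposition 0 (zero ∷ ds) 2 1 1 (toℕ p-1) (toℕ p-2)
  twoCarries-borrow (zero ∷ zero ∷ ds) eq₁ eq₂ =
    plainᵈ zero zero refl (plainᵈ zero zero refl (twoCarries-borrow ds eq₁ eq₂))
  twoCarries-borrow (zero ∷ suc zero ∷ ds) eq₁ eq₂ =
    subst₂ (λ i j → Decomposition 0 (zero ∷ zero ∷ suc zero ∷ ds) 2 1 1 i j) (+-identityʳ _) (+-identityʳ _)
      (carryᵈ one p-1 (trans (+-identityʳ _) 1+[p-1]≡p)
        (carryᵈ one p-2 (trans (cong (λ x → suc x + 1) toℕ-p-2) (cong suc (+-comm q 1)))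
          (plainᵈ zero zero refl
            (splitDigits ds {0} {0} {0} {0} (sym eq₁) (sym (suc-injective eq₂))))))

  -- For adjacent digits 1 the upper one lends to the lower, which lends to a zero below it; the
  -- prepended `zero` makes sure that there is one.
  twoCarries-shifted : (ds : Expansion p) → evenDigitSum ds ≡ 1 → oddDigitSum ds ≡ 1 →
    Witness (p + 1) 2 (zero ∷ ds)
  -- Two consecutive borrows need two positions below the upper digit 1, and these are missing only
  -- in `p + 1`.
  twoCarries-11 : (ds : Expansion p) → evenDigitSum ds ≡ 1 → oddDigitSum ds ≡ 1 →
    fromDigits ds ≢ p + 1 → Witness (p + 1) 2 ds

  private
    twoCarries-10 : (ds : Expansion p) → evenDigitSum ds ≡ 0 → oddDigitSum ds ≡ 1 →
      Witness (p + 1) 2 (suc zero ∷ zero ∷ ds)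
    twoCarries-10 ds eq₁ eq₂ =
      witness ∣-refl (plainᵈ zero one refl (twoCarries-borrow ds eq₁ eq₂)) (∣p+1⇒∣1+1*p ∣-refl)
        (s≤s z≤n) (s≤s z≤n)

  twoCarries-shifted (zero ∷ ds) eq₁ eq₂ = prependZero (twoCarries-shifted ds eq₂ eq₁)
  twoCarries-shifted (suc zero ∷ suc zero ∷ ds) eq₁ eq₂ =
    witness ∣-refl
      (carryᵈ one p-1 (trans (+-identityʳ _) 1+[p-1]≡p)
        (carryᵈ one p-1 (trans (cong (λ x → suc x + 1) toℕ-p-1) (cong (λ n → 2+ n) (+-comm q 1)))
          (plainᵈ zero zero refl
            (splitDigits ds {0} {0} {0} {0} (sym (suc-injective eq₁)) (sym (suc-injective eq₂))))))
      (∣p+1⇒∣1+1*p ∣-refl) (s≤s z≤n) (s≤s z≤n)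
  twoCarries-shifted (suc zero ∷ zero ∷ ds) eq₁ eq₂ =
    prependZero (twoCarries-10 ds (suc-injective eq₁) eq₂)

  twoCarries-11 (zero ∷ ds) eq₁ eq₂ _ = twoCarries-shifted ds eq₂ eq₁
  twoCarries-11 (suc zero ∷ suc zero ∷ ds) eq₁ eq₂ N≢p+1 = contradiction (begin
    1 + (1 + fromDigits ds * p) * p ≡⟨ cong (λ n → 1 + (1 + n * p) * p)
                                         (digitSums≡0⇒fromDigits≡0 ds (suc-injective eq₁) (suc-injective eq₂)) ⟩
    1 + 1 * p                       ≡⟨ cong suc (*-identityˡ p) ⟩
    1 + p                           ≡⟨ +-comm 1 p ⟩
    p + 1                           ∎) N≢p+1
    where open ≡-Reasoning
  twoCarries-11 (suc zero ∷ zero ∷ ds) eq₁ eq₂ _ = twoCarries-10 ds (suc-injective eq₁) eq₂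

-- Digit sums that admit no proper splitting.

-- Modulo `m` the factor `p` is the unit -1.
∣*⇒∣ : ∀ {m p} b → m ∣ p + 1 → m ∣ b * p → m ∣ b
∣*⇒∣ {m} {p} b m∣p+1 m∣bp = ∣m+n∣m⇒∣n (subst (m ∣_) (distrib b p) (∣n⇒∣m*n b m∣p+1)) m∣bp
  where
  distrib : ∀ b p → b * (p + 1) ≡ b * p + b
  distrib = solve-∀

positive⇒¬zeroSums : ∀ {p} (ds : Expansion p) → 0 < fromDigits ds →
  evenDigitSum ds ≡ 0 → ¬ oddDigitSum ds ≡ 0
positive⇒¬zeroSums ds 0<n eq₁ eq₂ = <⇒≢ 0<n (sym (digitSums≡0⇒fromDigits≡0 ds eq₁ eq₂))

-- A multiple of `m` that is at most `m` is 0 or `m`.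
∣summand : ∀ {m a b} → m ∣ a → a + b ≡ m → a ≡ 0 ⊎ b ≡ 0
∣summand {a = zero}      m∣a eq = inj₁ refl
∣summand {a = suc a} {b} m∣a eq = inj₂ (n≤0⇒n≡0 (+-cancelˡ-≤ (suc a) b 0
  (≤-trans (≤-reflexive eq) (≤-trans (∣⇒≤ m∣a) (m≤m+n (suc a) 0)))))

module _ {m p : ℕ} .{{_ : NonZero p}} (m∣p+1 : m ∣ p + 1) where

  -- The odd sums vanish, so the even sum of `ks` is a multiple of `m` that is at most `m`; one of
  -- the summands then has only zero digits.
  ¬proper-m0 : ∀ ks ls → Proper m ks ls →
    evenDigitSum ks + evenDigitSum ls ≡ m → ¬ oddDigitSum ks + oddDigitSum ls ≡ 0
  ¬proper-m0 ks ls (m∣k , 0<k , 0<l) even≡ odd≡ with ∣summand m∣even even≡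
    where
    m∣even : m ∣ evenDigitSum ks
    m∣even = subst (m ∣_)
      (trans (cong (λ b → evenDigitSum ks + b * p) (m+n≡0⇒m≡0 (oddDigitSum ks) odd≡)) (+-identityʳ _))
      (∣fromDigits⇒∣digitSums ks m∣p+1 m∣k)
  ... | inj₁ eq = positive⇒¬zeroSums ks 0<k eq (m+n≡0⇒m≡0 _ odd≡)
  ... | inj₂ eq = positive⇒¬zeroSums ls 0<l eq (m+n≡0⇒n≡0 (oddDigitSum ks) odd≡)

  ¬proper-0m : ∀ ks ls → Proper m ks ls →
    evenDigitSum ks + evenDigitSum ls ≡ 0 → ¬ oddDigitSum ks + oddDigitSum ls ≡ m
  ¬proper-0m ks ls (m∣k , 0<k , 0<l) even≡ odd≡ with ∣summand m∣odd odd≡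
    where
    m∣odd : m ∣ oddDigitSum ks
    m∣odd = ∣*⇒∣ _ m∣p+1 (subst (m ∣_)
      (cong (_+ oddDigitSum ks * p) (m+n≡0⇒m≡0 (evenDigitSum ks) even≡))
      (∣fromDigits⇒∣digitSums ks m∣p+1 m∣k))
  ... | inj₁ eq = positive⇒¬zeroSums ks 0<k (m+n≡0⇒m≡0 _ even≡) eq
  ... | inj₂ eq = positive⇒¬zeroSums ls 0<l (m+n≡0⇒n≡0 (evenDigitSum ks) even≡) eq

  -- A proper part would be (1 , 0) or (0 , 1), with the values 1 and `p`, both prime to `m`.
  ¬proper-11 : 2 ≤ m → ∀ ks ls → Proper m ks ls →
    evenDigitSum ks + evenDigitSum ls ≡ 1 → ¬ oddDigitSum ks + oddDigitSum ls ≡ 1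
  ¬proper-11 2≤m ks ls (m∣k , 0<k , 0<l) even≡ odd≡
    with evenDigitSum ks in a≡ | oddDigitSum ks in b≡ | ∣fromDigits⇒∣digitSums ks m∣p+1 m∣k
  ... | 0 | 0 | _   = positive⇒¬zeroSums ks 0<k a≡ b≡
  ... | 1 | 1 | _   = positive⇒¬zeroSums ls 0<l (suc-injective even≡) (suc-injective odd≡)
  ... | 1 | 0 | m∣1 = >⇒∤ 2≤m m∣1
  ... | 0 | 1 | m∣p = >⇒∤ 2≤m (∣*⇒∣ 1 m∣p+1 m∣p)
  ... | 2+ _ | _ | _ = contradiction even≡ λ ()
  ... | _ | 2+ _ | _ = contradiction odd≡ λ ()

-- Admissible summands without carries.

module _ {q m : ℕ} (m∣p+1 : m ∣ 2+ q + 1) (2≤m : 2 ≤ m) where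

  -- If both digit sums are positive, (1 , 1) is split off. If one vanishes, the other is a multiple
  -- of `m` different from `m`, and `m` is split off from it.
  noCarry : (ds : Expansion (2+ q)) → m ∣ fromDigits ds → 0 < fromDigits ds →
    (evenDigitSum ds , oddDigitSum ds) ≢ (1 , 1) →
    (evenDigitSum ds , oddDigitSum ds) ≢ (m , 0) →
    (evenDigitSum ds , oddDigitSum ds) ≢ (0 , m) → Witness m 0 ds
  noCarry ds m∣N 0<N ≢11 ≢m0 ≢0m
    with evenDigitSum ds in A≡ | oddDigitSum ds in B≡ | ∣fromDigits⇒∣digitSums ds m∣p+1 m∣N
  ... | zero  | zero  | _  = contradiction B≡ (positive⇒¬zeroSums ds 0<N A≡)
  ... | suc zero | suc zero | _ = contradiction refl ≢11
  ... | suc a@(suc _) | suc b | _ = witness m∣p+1 (splitDigits ds {1} {a} {1} {b} (sym A≡) (sym B≡))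
        (∣p+1⇒∣1+1*p m∣p+1)
        (s≤s z≤n) (s≤s z≤n)
  ... | suc zero | suc b@(suc _) | _ = witness m∣p+1 (splitDigits ds {1} {0} {1} {b} (sym A≡) (sym B≡))
        (∣p+1⇒∣1+1*p m∣p+1)
        (s≤s z≤n) (s≤s z≤n)
  ... | a@(suc _) | zero  | m∣a+0 =
        witness m∣p+1
          (splitDigits ds {m} {a ∸ m} {0} {0} (trans (m+[n∸m]≡n (<⇒≤ m<a)) (sym A≡)) (sym B≡))
          (subst (m ∣_) (sym (+-identityʳ m)) ∣-refl)
          (≤-trans (<⇒≤ 2≤m) (m≤m+n m 0)) (≤-trans (m<n⇒0<n∸m m<a) (m≤m+n _ 0))
    where
    m<a : m < a
    m<a = ≤∧≢⇒< (∣⇒≤ (subst (m ∣_) (+-identityʳ a) m∣a+0)) λ m≡a → ≢m0 (cong (_, 0) (sym m≡a))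
  ... | zero  | b@(suc _) | m∣bp =
        witness m∣p+1
          (splitDigits ds {0} {0} {m} {b ∸ m} (sym A≡) (trans (m+[n∸m]≡n (<⇒≤ m<b)) (sym B≡)))
          (m∣m*n (2+ q))
          (<⇒≤ 2≤m) (m<n⇒0<n∸m m<b)
    where
    m<b : m < b
    m<b = ≤∧≢⇒< (∣⇒≤ (∣*⇒∣ b m∣p+1 m∣bp)) λ m≡b → ≢0m (cong (0 ,_) (sym m≡b))

-- From numbers of carries to the exponent of `p` in `G`.

module _ {q m : ℕ} (p-prime : Prime (2+ q)) where

  witness⇒^∤G : ∀ {e} {ds : Expansion (2+ q)} → Witness m e ds → ¬ 2+ q ^ suc e ∣ G (fromDigits ds) m
  witness⇒^∤G (ks , ls , add , m∣k , 0<k , 0<l) pᵉ⁺¹∣G =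
    ^suc-carries∤C p-prime add (∣-trans pᵉ⁺¹∣G (G∣C 0<k k<N m∣k))
    where
    k<N : fromDigits ks < _
    k<N = subst (fromDigits ks <_) (trans (sym (+-identityʳ _)) (addition-sound add))
      (m<m+n (fromDigits ks) 0<l)

  -- By `addition-complete` every admissible `k` is the first summand of some addition with sum
  -- `ds`, so the bound covers all terms of the gcd.
  carries≥⇒^∣G : ∀ {e} {ds : Expansion (2+ q)} →
    (∀ {ks ls f} → Addition 0 ks ls ds f → Proper m ks ls → e ≤ f) →
    2+ q ^ e ∣ G (fromDigits ds) m
  carries≥⇒^∣G {e} {ds} e≤ = ∣G ∣C
    where
    ∣C : ∀ {k} → 0 < k → k < fromDigits ds → m ∣ k → 2+ q ^ e ∣ fromDigits ds C k
    ∣C {k} 0<k k<N m∣k with addition-complete ds k (fromDigits ds ∸ k) z≤n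
      (trans (+-identityʳ _) (m+[n∸m]≡n (<⇒≤ k<N)))
    ... | ks , ls , f , add , refl , l≡ =
      ∣-trans (^-monoʳ-∣ (2+ q) (e≤ add (m∣k , 0<k , subst (0 <_) (sym l≡) (m<n⇒0<n∸m k<N))))
        (^carries∣C p-prime add)

carries≥1 : ∀ {p} {P : Expansion p → Expansion p → Set} {ds : Expansion p} →
  (∀ ks ls → P ks ls → evenDigitSum ks + evenDigitSum ls ≡ evenDigitSum ds →
    ¬ oddDigitSum ks + oddDigitSum ls ≡ oddDigitSum ds) →
  ∀ {ks ls f} → Addition 0 ks ls ds f → P ks ls → 1 ≤ f
carries≥1 ¬P {ks} {ls} {zero}  add P =
  let even≡ , odd≡ = digitSums-noCarry add refl
  in contradiction odd≡ (¬P ks ls P (trans (sym (+-identityʳ _)) even≡))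
carries≥1 ¬P {f = suc f} add P = s≤s z≤n

carries≥2 : ∀ {p} .{{_ : NonZero p}} {m} {ds : Expansion p} → m ≡ p + 1 →
  evenDigitSum ds ≡ 1 → oddDigitSum ds ≡ 1 →
  ∀ {ks ls f} → Addition 0 ks ls ds f → Proper m ks ls → 2 ≤ f
carries≥2 {p} refl A≡ B≡ {ks} {ls} {0} add P =
  let even≡ , odd≡ = digitSums-noCarry add refl
  in contradiction (trans odd≡ B≡) (¬proper-11 ∣-refl
       (+-monoˡ-≤ 1 (>-nonZero⁻¹ p)) ks ls P (trans (sym (+-identityʳ _)) (trans even≡ A≡)))
carries≥2 {p} refl A≡ B≡ {ks} {ls} {1} add P with digitSums-oneCarry add refl
-- One carry turns (1 , 1) into (p + 1 , 0) here and into (0 , p + 1) below, that is, into (m , 0)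
-- and (0 , m).
... | inj₁ (even≡ , odd≡) = contradiction (+-cancelʳ-≡ 1 _ 0 (trans odd≡ B≡))
  (¬proper-m0 ∣-refl ks ls P
    (trans (sym (+-identityʳ _)) (trans even≡ (trans (cong (_+ p) A≡) (+-comm 1 p)))))
... | inj₂ (even≡ , odd≡) = contradiction (trans odd≡ (trans (cong (_+ p) B≡) (+-comm 1 p)))
  (¬proper-0m ∣-refl ks ls P
    (trans (sym (+-identityʳ _)) (+-cancelʳ-≡ 1 _ 0 (trans even≡ A≡))))
carries≥2 _ _ _ {f = 2+ _} _ _ = s≤s (s≤s z≤n)

-- A divisor of `p + 1` other than `p + 1` is at most `p`, and `m = p` would divide 1.
divisor-of-1+p : ∀ {m p} → 2 ≤ m → m ∣ p + 1 → p ≡ m ∸ 1 ⊎ m < p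
divisor-of-1+p {m} {p} 2≤m m∣p+1 with m≤n⇒m<n∨m≡n (∣⇒≤ {n = suc p} (subst (m ∣_) (+-comm p 1) m∣p+1))
... | inj₂ refl = inj₁ refl
... | inj₁ (s≤s m≤p) = inj₂ (≤∧≢⇒< m≤p λ { refl → >⇒∤ 2≤m (∣m+n∣m⇒∣n m∣p+1 ∣-refl) })

-- The four cases, each from a lower bound on carries and a summand attaining it.

open import Data.Integer.Base using (+_; -1ℤ)

theorem1p1 : (m N p : ℕ) → 3 ≤ m → m ∣ N → m < N →
    Prime p → + p ≡ -1ℤ [mod m ] →
    (ds : Expansion p) → fromDigits ds ≡ N →
    let A  = evenDigitSum ds
        B  = oddDigitSum ds
        c₁ = (A , B) ≡ (1 , 1) × p ≡ m ∸ 1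
        c₂ = (A , B) ≡ (1 , 1) × m < p
        c₃ = (A , B) ≡ (m , 0) ⊎ (A , B) ≡ (0 , m)
    in (c₁ → v p (G N m) ≡ 2)
    × (c₂ → v p (G N m) ≡ 1)
    × (c₃ → v p (G N m) ≡ 1)
    × (¬ (c₁ ⊎ c₂ ⊎ c₃) → v p (G N m) ≡ 0)
theorem1p1 m _ zero          3≤m m∣N m<N p-prime m∣p+1 ds refl = contradiction p-prime ¬prime[0]
theorem1p1 m _ (suc zero)    3≤m m∣N m<N p-prime m∣p+1 ds refl = contradiction p-prime ¬prime[1]
-- The congruence unfolds to `m ∣ p + 1` by computation and is used in that form.
theorem1p1 m@(suc _) _ p@(suc (suc q)) 3≤m m∣N m<N p-prime m∣p+1 ds refl = case₁ , case₂ , case₃ , case₀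
  where
  A = evenDigitSum ds
  B = oddDigitSum ds

  2≤m : 2 ≤ m
  2≤m = <⇒≤ 3≤m

  v≡ : ∀ {e} → (∀ {ks ls f} → Addition 0 ks ls ds f → Proper m ks ls → e ≤ f) →
       Witness m e ds → v p (G (fromDigits ds) m) ≡ e
  v≡ lower upper = v-unique (s≤s (s≤s z≤n)) (carries≥⇒^∣G p-prime lower) (witness⇒^∤G p-prime upper)

  case₁ : (A , B) ≡ (1 , 1) × p ≡ m ∸ 1 → v p (G (fromDigits ds) m) ≡ 2
  case₁ (AB≡ , p≡m-1) = v≡
    (carries≥2 m≡ A≡ B≡)
    -- Here `p + 1` is `m`, so `m < N` excludes the exceptional value of `twoCarries-11`.
    (subst (λ x → Witness x 2 ds) (sym m≡) (twoCarries-11 ds A≡ B≡ λ N≡ → <⇒≢ m<N (trans m≡ (sym N≡))))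
    where
    A≡ = cong proj₁ AB≡
    B≡ = cong proj₂ AB≡
    m≡ : m ≡ p + 1
    m≡ = trans (cong suc (sym p≡m-1)) (+-comm 1 p)

  case₂ : (A , B) ≡ (1 , 1) × m < p → v p (G (fromDigits ds) m) ≡ 1
  case₂ (AB≡ , m<p) = v≡ (carries≥1 λ ks ls P even≡ odd≡ →
      ¬proper-11 m∣p+1 2≤m ks ls P (trans even≡ A≡) (trans odd≡ B≡))
    (oneCarry-11 ds m∣p+1 2≤m m<p A≡ B≡)
    where
    A≡ = cong proj₁ AB≡
    B≡ = cong proj₂ AB≡

  case₃ : (A , B) ≡ (m , 0) ⊎ (A , B) ≡ (0 , m) → v p (G (fromDigits ds) m) ≡ 1
  case₃ (inj₁ AB≡) = v≡ (carries≥1 λ ks ls P even≡ odd≡ →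
      ¬proper-m0 m∣p+1 ks ls P (trans even≡ (cong proj₁ AB≡)) (trans odd≡ (cong proj₂ AB≡)))
    (oneCarry-pureEven ds m∣p+1 2≤m (cong proj₁ AB≡) (cong proj₂ AB≡) m<N)
  case₃ (inj₂ AB≡) = v≡ (carries≥1 λ ks ls P even≡ odd≡ →
      ¬proper-0m m∣p+1 ks ls P (trans even≡ (cong proj₁ AB≡)) (trans odd≡ (cong proj₂ AB≡)))
    (oneCarry-pureOdd ds m∣p+1 2≤m (cong proj₁ AB≡) (cong proj₂ AB≡))

  case₀ : ¬ ((A , B) ≡ (1 , 1) × p ≡ m ∸ 1 ⊎ (A , B) ≡ (1 , 1) × m < p ⊎
             ((A , B) ≡ (m , 0) ⊎ (A , B) ≡ (0 , m))) → v p (G (fromDigits ds) m) ≡ 0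
  case₀ none = v≡ (λ _ _ → z≤n) (noCarry m∣p+1 2≤m ds m∣N (≤-<-trans z≤n m<N)
    -- By `divisor-of-1+p` the pair (1 , 1) always falls under one of the first two cases.
    (λ AB≡ → [ (λ p≡ → none (inj₁ (AB≡ , p≡))) , (λ m<p → none (inj₂ (inj₁ (AB≡ , m<p)))) ]′
               (divisor-of-1+p 2≤m m∣p+1))
    (none ∘ inj₂ ∘ inj₂ ∘ inj₁) (none ∘ inj₂ ∘ inj₂ ∘ inj₂))
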